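{- Let $q$ be a prime power with $q\equiv 1 \pmod 6$. Then the covering radius of $\mathrm{PGL}_2(q)$, viewed as a subset of the symmetric group on the $q+1$ points of the projective line $\mathbb{F}_q\cup\{\infty\}$, equals $q-3$.
   Context: For $n\geq 2$, the Hamming distance on the symmetric group $S_n$ is $d(g,h)=n-|\mathrm{fix}(gh^{ -1})|$, where $\mathrm{fix}$ denotes the set of fixed points. For a subset $C\subseteq S_n$ and $v\in S_n$, $d(v,C)=\min\{d(v,c)\mid c\in C\}$, and the covering radius of $C$ is $\max\{d(v,C)\mid v\in S_n\}$. The group $\mathrm{PGL}_2(q)$ acts faithfully on $\mathbb{F}_q\cup\{\infty\}$ by linear fractional transformations $x\mapsto (ax+b)/(cx+d)$, $ad-bc\neq 0$, and is thereby regarded as a subgroup of $S_{q+1}$. -}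

module Defs where

open import Level using (0ℓ)
open import Data.Nat using (ℕ; _∸_; _≤_; _^_; _%_)
open import Data.Nat.Primality using (Prime)
open import Data.Fin using (Fin)
open import Data.List using (List; []; _∷_; map; filter; length; allFin)
open import Data.Maybe using (Maybe; just; nothing)
open import Data.Product using (Σ; ∃; _×_; _,_)
open import Relation.Nullary using (¬_; Dec; yes; no)
open import Relation.Binary.PropositionalEquality using (_≡_; _≢_)
open import Algebra.Structures using (IsCommutativeRing)
open import Function.Bundles using (_↔_; Inverse)

IsPrimePower : ℕ → Set
IsPrimePower q = Σ ℕ λ p → Σ ℕ λ k → Prime p × 1 ≤ k × q ≡ p ^ k

record FiniteField (q : ℕ) : Set₁ where
  infixl 6 _+_ _-_
  infixl 7 _*_
  field
    Carrier : Set
    _+_ _*_ : Carrier → Carrier → Carrier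
    -_      : Carrier → Carrier
    0# 1#   : Carrier
    isCommutativeRing : IsCommutativeRing _≡_ _+_ _*_ -_ 0# 1#
    0≢1     : 0# ≢ 1#
    _⁻¹     : Carrier → Carrier
    ⁻¹-inverse : ∀ x → x ≢ 0# → x * (x ⁻¹) ≡ 1#
    _≟_     : (x y : Carrier) → Dec (x ≡ y)
    enum    : Fin q ↔ Carrier

  _-_ : Carrier → Carrier → Carrier
  x - y = x + (- y)

Perm : Set → Set
Perm A = A ↔ A

module SymmetricGroup (A : Set) (_≟A_ : (x y : A) → Dec (x ≡ y))
                      (n : ℕ) (elems : List A) where
  -- `elems` is meant to list every element of A exactly once; n = |A|

  fix : (A → A) → List A
  fix σ = filter (λ x → σ x ≟A x) elems

  dist : Perm A → Perm A → ℕ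
  dist g h = n ∸ length (fix (λ x → Inverse.to g (Inverse.from h x)))

  DistToSetIs : (Perm A → Set) → Perm A → ℕ → Set
  DistToSetIs C v r =
    (Σ (Perm A) λ c → C c × dist v c ≡ r) × (∀ c → C c → r ≤ dist v c)

  CoveringRadiusIs : (Perm A → Set) → ℕ → Set
  CoveringRadiusIs C r =
    (∀ v → Σ ℕ λ s → DistToSetIs C v s × s ≤ r) ×
    (Σ (Perm A) λ v → DistToSetIs C v r)

module ProjectiveLine {q : ℕ} (𝔽 : FiniteField q) where
  open FiniteField 𝔽

  -- nothing = ∞
  P¹ : Set
  P¹ = Maybe Carrier

  _≟P_ : (x y : P¹) → Dec (x ≡ y)
  nothing ≟P nothing = yes Relation.Binary.PropositionalEquality.refl
  nothing ≟P just _  = no λ ()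
  just _  ≟P nothing = no λ ()
  just x  ≟P just y with x ≟ y
  ... | yes Relation.Binary.PropositionalEquality.refl = yes Relation.Binary.PropositionalEquality.refl
  ... | no x≢y = no λ { Relation.Binary.PropositionalEquality.refl → x≢y Relation.Binary.PropositionalEquality.refl }

  points : List P¹
  points = nothing ∷ map (λ i → just (Inverse.to enum i)) (allFin q)

  möbius : (a b c d : Carrier) → P¹ → P¹
  möbius a b c d nothing with c ≟ 0#
  ... | yes _ = nothing
  ... | no  _ = just (a * (c ⁻¹))
  möbius a b c d (just x) with (c * x + d) ≟ 0#
  ... | yes _ = nothing
  ... | no  _ = just ((a * x + b) * ((c * x + d) ⁻¹))

  InPGL₂ : Perm P¹ → Set
  InPGL₂ g = Σ Carrier λ a → Σ Carrier λ b → Σ Carrier λ c → Σ Carrier λ d →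
             (a * d - b * c ≢ 0#) × (∀ x → Inverse.to g x ≡ möbius a b c d x)

  open SymmetricGroup P¹ _≟P_ (Data.Nat.suc q) points public

{-# OPTIONS --safe #-}
module Submission where

-- Write P for the product of all nonzero elements of F; by Wilson P = -1 ≠ 1.
--
-- Upper bound. Given a permutation v, there is a one-parameter family of Möbius
-- maps, indexed by γ ∈ F*, that agree with v at ∞ and at one further point z: if
-- v fixes ∞, take z = 0 and γx + v(0); otherwise let z be the point sent to ∞ and
-- take v(∞) + γ/(x - z).  Any other x has exactly one γ for which the map agrees
-- with v at x, and this γ is a product of two bijections onto F* evaluated at x.
-- If x ↦ γ were injective, multiplying over all x would give P = P·P, so P = 1.
-- Hence two points share a γ, and that map agrees with v in four points.
--
-- Lower bound. Cubing is a bijection of the cyclic group F(√ε)*/F* of order q + 1,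
-- where ε is a nonsquare, because 3 does not divide q + 1.  In the coordinate x of
-- x + √ε it is the Rédei function R(x) = (x³ + 3εx)/(3x² + ε), whose injectivity
-- reduces to -3 being a square.  Agreements of R with a Möbius map are roots of a
-- polynomial of degree at most 4, or at most 3 when ∞ is an agreement.

open import Defs
open import Level using (0ℓ)
open import Algebra.Bundles using (CommutativeRing)
open import Algebra.Solver.Ring.AlmostCommutativeRing using (fromCommutativeRing; _-Raw-AlmostCommutative⟶_)
open import Data.Integer as ℤ using (ℤ; -[1+_]) renaming (+_ to pos)
import Data.Integer.Properties as ℤ
open import Data.List using (List; []; _∷_; _++_; map; concatMap; length; foldr; filter; cartesianProduct; allFin)
open import Data.List.Extrema.Nat using (argmin; f[argmin]≤f[xs])
open import Data.List.Membership.Propositional using (_∈_; _∉_; lose)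
open import Data.List.Membership.Propositional.Properties
  using (∈-∃++; ∈-++⁻; ∈-++⁺ʳ; ∈-map⁺; ∈-map⁻; ∈-allFin; ∈-filter⁺; ∈-filter⁻; ∈-cartesianProduct⁺)
open import Data.List.Properties using (length-++; length-map; length-tabulate; ++-identityʳ; map-∘; filter-≐)
open import Data.List.Relation.Binary.Permutation.Propositional as ↭ using (_↭_; ↭-refl; ↭-sym; ↭-trans; prep; ↭⇒↭ₛ)
open import Data.List.Relation.Binary.Permutation.Propositional.Properties using (shift; ∈-resp-↭; ↭-length; ++⁺ˡ)
import Data.List.Relation.Binary.Permutation.Setoid.Properties as ↭ₛ
open import Data.List.Relation.Binary.Subset.Propositional using (_⊆_)
open import Data.List.Relation.Unary.All as All using (All; []; _∷_)
import Data.List.Relation.Unary.All.Properties as All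
open import Data.List.Relation.Unary.AllPairs using ([]; _∷_)
open import Data.List.Relation.Unary.Any as Any using (here; there)
open import Data.List.Relation.Unary.Unique.Propositional using (Unique)
import Data.List.Relation.Unary.Unique.Propositional.Properties as Unique
open import Data.Maybe as Maybe using (just; nothing)
open import Data.Maybe.Properties using (just-injective; map-injective)
open import Data.Nat as ℕ using (ℕ; zero; suc; s≤s; _∸_; _%_; _/_)
open import Data.Nat.DivMod using (m≡m%n+[m/n]*n)
open import Data.Nat.Divisibility using (_∣_; divides; ∣m+n∣m⇒∣n; ∣-trans; n∣m*n; ∣1⇒≡1)
import Data.Nat.Properties as ℕ
open import Data.Product using (Σ; ∃; _×_; _,_; proj₁; proj₂)
open import Data.Sum using (inj₁; inj₂)
open import Function using (_∘_)
open import Function.Bundles using (_↔_; Inverse; mk↔ₛ′)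
open import Relation.Binary.PropositionalEquality as ≡
  using (_≡_; _≢_; refl; sym; trans; cong; cong₂; subst; module ≡-Reasoning)
open import Relation.Nullary using (¬_; Dec; yes; no; contradiction)
open import Relation.Nullary.Decidable using (dec⇒maybe; decidable-stable; ¬?; _×-dec_)

-- Duplicate-free lists as finite sets.

module _ {A : Set} where

  unique-resp-↭ : {xs ys : List A} → xs ↭ ys → Unique xs → Unique ys
  unique-resp-↭ p = ↭ₛ.Unique-resp-↭ (≡.setoid A) (↭⇒↭ₛ p)

  unique-++⇒disjoint : ∀ (xs : List A) {ys x} → Unique (xs ++ ys) → x ∈ xs → x ∉ ys
  unique-++⇒disjoint (x ∷ xs) (x∉ ∷ _) (here refl) x∈ys = All.lookup x∉ (∈-++⁺ʳ xs x∈ys) refl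
  unique-++⇒disjoint (x ∷ xs) (_ ∷ u)  (there x∈)  x∈ys = unique-++⇒disjoint xs u x∈ x∈ys

  unique-++⇒uniqueʳ : ∀ (xs : List A) {ys} → Unique (xs ++ ys) → Unique ys
  unique-++⇒uniqueʳ []       u       = u
  unique-++⇒uniqueʳ (x ∷ xs) (_ ∷ u) = unique-++⇒uniqueʳ xs u

  -- Each head of `xs` is cut out of `ys`. The tail still lies in what is left, because the head
  -- does not recur in it.
  unique-⊆⇒split : {xs ys : List A} → Unique xs → xs ⊆ ys → ∃ λ zs → ys ↭ xs ++ zs
  unique-⊆⇒split {[]}     {ys} []       _     = ys , ↭-refl
  unique-⊆⇒split {x ∷ xs} {ys} (x∉ ∷ u) xs⊆ys with ∈-∃++ (xs⊆ys (here refl))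
  ... | as , bs , refl with unique-⊆⇒split u xs⊆rest
    where
    xs⊆rest : xs ⊆ as ++ bs
    xs⊆rest y∈xs with ∈-resp-↭ (shift x as bs) (xs⊆ys (there y∈xs))
    ... | here refl = contradiction refl (All.lookup x∉ y∈xs)
    ... | there y∈  = y∈
  ... | zs , p = zs , ↭-trans (shift x as bs) (prep x p)

  unique-⊆⇒length≤ : {xs ys : List A} → Unique xs → xs ⊆ ys → length xs ℕ.≤ length ys
  unique-⊆⇒length≤ {xs} {ys} u xs⊆ys with unique-⊆⇒split u xs⊆ys
  ... | zs , p = subst (length xs ℕ.≤_)
                   (sym (trans (↭-length p) (length-++ xs)))
                   (ℕ.m≤m+n (length xs) (length zs))

  -- Pigeonhole: equal lengths force the remainder of the split to be empty.
  unique-⊆⇒↭ : {xs ys : List A} → Unique xs → xs ⊆ ys → length xs ≡ length ys → xs ↭ ys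
  unique-⊆⇒↭ {xs} u xs⊆ys eq with unique-⊆⇒split u xs⊆ys
  ... | []     , p = ↭-sym (subst (_ ↭_) (++-identityʳ xs) p)
  ... | z ∷ zs , p = contradiction
    (trans eq (trans (↭-length p) (length-++ xs)))
    (ℕ.m≢1+m+n (length xs) ∘ λ e → trans e (ℕ.+-suc (length xs) (length zs)))

  record Complement (xs ys : List A) : Set where
    field
      rest    : List A
      split   : ys ↭ xs ++ rest
      unique  : Unique rest
      ∈-rest⁺ : ∀ {x} → x ∈ ys → x ∉ xs → x ∈ rest
      ∈-rest⁻ : ∀ {x} → x ∈ rest → x ∈ ys × x ∉ xs

  abstract
    complement : {xs ys : List A} → Unique xs → Unique ys → xs ⊆ ys → Complement xs ys
    complement {xs} {ys} uxs uys xs⊆ys with unique-⊆⇒split uxs xs⊆ys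
    ... | zs , p = record
      { rest    = zs
      ; split   = p
      ; unique  = unique-++⇒uniqueʳ xs u
      ; ∈-rest⁺ = ∈⁺
      ; ∈-rest⁻ = λ x∈ → ∈-resp-↭ (↭-sym p) (∈-++⁺ʳ xs x∈) , λ x∈xs → unique-++⇒disjoint xs u x∈xs x∈
      }
      where
      u : Unique (xs ++ zs)
      u = unique-resp-↭ p uys
      ∈⁺ : ∀ {x} → x ∈ ys → x ∉ xs → x ∈ zs
      ∈⁺ x∈ x∉ with ∈-++⁻ xs (∈-resp-↭ p x∈)
      ... | inj₁ x∈xs = contradiction x∈xs x∉
      ... | inj₂ x∈zs = x∈zs

  unique-map : ∀ {B : Set} {f : A → B} {xs : List A} →
               (∀ {x y} → x ∈ xs → y ∈ xs → f x ≡ f y → x ≡ y) → Unique xs → Unique (map f xs)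
  unique-map         inj []       = []
  unique-map {f = f} inj (x∉ ∷ u) =
    All.map⁺ (All.tabulate λ y∈ eq → All.lookup x∉ y∈ (inj (here refl) (there y∈) eq))
    ∷ unique-map (λ x∈ y∈ → inj (there x∈) (there y∈)) u

  -- The image is a duplicate-free part of `xs` of full length. This serves both to reindex products
  -- and to invert injective maps.
  map-injective⇒↭ : {f : A → A} {xs : List A} →
                    (∀ {x y} → x ∈ xs → y ∈ xs → f x ≡ f y → x ≡ y) →
                    Unique xs → (∀ {x} → x ∈ xs → f x ∈ xs) → map f xs ↭ xs
  map-injective⇒↭ {f} {xs} inj u closed =
    unique-⊆⇒↭ (unique-map inj u) map⊆ (length-map f xs)
    where
    map⊆ : map f xs ⊆ xs
    map⊆ y∈ with ∈-map⁻ f y∈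
    ... | x , x∈ , refl = closed x∈

  abstract
    -- The inverse looks each point up in `map f xs`, a rearrangement of `xs`. As the result is
    -- `abstract`, the bijection is known later only through the returned equation.
    injective⇒↔ : {xs : List A} → Unique xs → (∀ x → x ∈ xs) →
                  (f : A → A) → (∀ {x y} → f x ≡ f y → x ≡ y) →
                  Σ (A ↔ A) λ p → ∀ x → Inverse.to p x ≡ f x
    injective⇒↔ {xs} u complete f inj =
      mk↔ₛ′ f (proj₁ ∘ pre) (sym ∘ proj₂ ∘ pre) (λ x → inj (sym (proj₂ (pre (f x))))) , λ _ → refl
      where
      pre : ∀ y → ∃ λ x → y ≡ f x
      pre y with ∈-map⁻ f (∈-resp-↭ (↭-sym (map-injective⇒↭ (λ _ _ → inj) u (λ _ → complete _))) (complete y))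
      ... | x , _ , eq = x , eq

  -- Partitions into orbits.

  -- The blocks o x behave like the classes of an equivalence relation on L.
  record Blocks (o : A → List A) (L : List A) : Set where
    field
      self   : ∀ x → x ∈ o x
      unique : ∀ {x} → x ∈ L → Unique (o x)
      closed : ∀ {x} → x ∈ L → o x ⊆ L
      meet   : ∀ {x y z} → x ∈ L → y ∈ L → z ∈ o x → z ∈ o y → y ∈ o x

  -- The block of the head is split off and the recursion continues on its complement; `n` bounds
  -- the length to ensure termination.
  blocks⇒partition : ∀ {o L} → Unique L → Blocks o L → ∃ λ M → M ⊆ L × L ↭ concatMap o M
  blocks⇒partition {o} {L} u B = go (length L) L ℕ.≤-refl u B
    where
    go : ∀ n L → length L ℕ.≤ n → Unique L → Blocks o L → ∃ λ M → M ⊆ L × L ↭ concatMap o M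
    go n       []       _         _ _ = [] , (λ x∈ → x∈) , ↭-refl
    go (suc n) L@(x ∷ xs) L≤ u B = extend (go n rest rest≤ uniqueR restBlocks)
      where
      open Blocks B
      open Complement (complement (unique (here refl)) u (closed (here refl))) renaming (unique to uniqueR)

      rest⊆xs : rest ⊆ xs
      rest⊆xs y∈ with ∈-rest⁻ y∈
      ... | here refl , y∉ = contradiction (self _) y∉
      ... | there y∈xs , _ = y∈xs

      rest≤ : length rest ℕ.≤ n
      rest≤ = ℕ.≤-trans (unique-⊆⇒length≤ uniqueR rest⊆xs) (ℕ.s≤s⁻¹ L≤)

      rest⊆L : rest ⊆ L
      rest⊆L = there ∘ rest⊆xs

      restBlocks : Blocks o rest
      restBlocks = record
        { self   = self
        ; unique = unique ∘ rest⊆L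
        -- A block that starts outside `o x` stays outside: by `meet`, a common element would put
        -- `y` into `o x`.
        ; closed = λ y∈ z∈ → ∈-rest⁺ (closed (rest⊆L y∈) z∈)
                     (λ z∈x → proj₂ (∈-rest⁻ y∈) (meet (here refl) (rest⊆L y∈) z∈x z∈))
        ; meet   = λ x∈ y∈ → meet (rest⊆L x∈) (rest⊆L y∈)
        }

      extend : (∃ λ M → M ⊆ rest × rest ↭ concatMap o M) → ∃ λ M → M ⊆ L × L ↭ concatMap o M
      extend (M , M⊆ , p) = x ∷ M , (λ { (here refl) → here refl ; (there y∈) → rest⊆L (M⊆ y∈) })
                          , ↭-trans split (++⁺ˡ (o x) p)

  length-concatMap : ∀ (o : A → List A) k → (∀ x → length (o x) ≡ k) →
                     ∀ M → length (concatMap o M) ≡ length M ℕ.* k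
  length-concatMap o k eq []      = refl
  length-concatMap o k eq (x ∷ M) =
    trans (length-++ (o x)) (cong₂ ℕ._+_ (eq x) (length-concatMap o k eq M))

  pair : (A → A) → A → List A
  pair t x = x ∷ t x ∷ []

  triple : (A → A) → A → List A
  triple t x = x ∷ t x ∷ t (t x) ∷ []

  involution⇒pairs : ∀ {L} (t : A → A) → Unique L → (∀ {x} → x ∈ L → t x ∈ L) →
                     (∀ {x} → x ∈ L → t (t x) ≡ x) → (∀ {x} → x ∈ L → t x ≢ x) →
                     ∃ λ M → M ⊆ L × L ↭ concatMap (pair t) M
  involution⇒pairs {L} t u t∈ t²≡id t≢ = blocks⇒partition u record
    { self   = λ _ → here refl
    ; unique = λ x∈ → ((t≢ x∈ ∘ sym) ∷ []) ∷ [] ∷ []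
    ; closed = λ { x∈ (here refl) → x∈ ; x∈ (there (here refl)) → t∈ x∈ }
    ; meet   = λ { _  _  z∈x (here refl) → z∈x
                 ; x∈ y∈ z∈x (there (here refl)) → subst (_∈ pair t _) (t²≡id y∈) (t-closed x∈ z∈x) }
    }
    where
    t-closed : ∀ {x z} → x ∈ L → z ∈ pair t x → t z ∈ pair t x
    t-closed x∈ (here refl)         = there (here refl)
    t-closed x∈ (there (here refl)) = here (t²≡id x∈)

  order3⇒triples : ∀ {L} (t : A → A) → Unique L → (∀ {x} → x ∈ L → t x ∈ L) →
                   (∀ {x} → x ∈ L → t (t (t x)) ≡ x) → (∀ {x} → x ∈ L → t x ≢ x) →
                   ∃ λ M → M ⊆ L × L ↭ concatMap (triple t) M
  order3⇒triples {L} t u t∈ t³≡id t≢ = blocks⇒partition u record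
    { self   = λ _ → here refl
    -- If x = t (t x), applying t once more gives t x = x.
    ; unique = λ x∈ → ((t≢ x∈ ∘ sym) ∷ (λ x≡ttx → t≢ x∈ (trans (cong t x≡ttx) (t³≡id x∈))) ∷ [])
                    ∷ ((t≢ (t∈ x∈) ∘ sym) ∷ []) ∷ [] ∷ []
    ; closed = λ { x∈ (here refl) → x∈
                 ; x∈ (there (here refl)) → t∈ x∈
                 ; x∈ (there (there (here refl))) → t∈ (t∈ x∈) }
    ; meet   = λ { _  _  z∈x (here refl) → z∈x
                 ; x∈ y∈ z∈x (there (here refl)) →
                     subst (_∈ triple t _) (t³≡id y∈) (t-closed x∈ (t-closed x∈ z∈x))
                 ; x∈ y∈ z∈x (there (there (here refl))) →
                     subst (_∈ triple t _) (t³≡id y∈) (t-closed x∈ z∈x) }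
    }
    where
    t-closed : ∀ {x z} → x ∈ L → z ∈ triple t x → t z ∈ triple t x
    t-closed x∈ (here refl)                 = there (here refl)
    t-closed x∈ (there (here refl))         = there (there (here refl))
    t-closed x∈ (there (there (here refl))) = here (t³≡id x∈)

-- Ring identities with integer coefficients.

-- The solver needs coefficients with decidable equality, hence the map ℤ → R.
module IntegerCoefficients (R : CommutativeRing 0ℓ 0ℓ) where
  open CommutativeRing R renaming (refl to ≈-refl; sym to ≈-sym; trans to ≈-trans; reflexive to ≈-reflexive)
  open import Algebra.Properties.Semiring.Mult.TCOptimised semiring
    using (×1-homo-*; ×-homo-+; 1+×) renaming (_×_ to _×′_)
  open import Algebra.Properties.Ring ring using (-0#≈0#; -‿involutive; -‿distribˡ-*; -‿distribʳ-*)
  open import Algebra.Properties.AbelianGroup +-abelianGroup using (⁻¹-∙-comm)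
  open import Relation.Binary.Reasoning.Setoid setoid

  ⟦_⟧ℤ : ℤ → Carrier
  ⟦ pos n ⟧ℤ    = n ×′ 1#
  ⟦ -[1+ n ] ⟧ℤ = - (suc n ×′ 1#)

  neg-homo : ∀ i → ⟦ ℤ.- i ⟧ℤ ≈ - ⟦ i ⟧ℤ
  neg-homo (pos zero)    = ≈-sym -0#≈0#
  neg-homo (pos (suc n)) = ≈-refl
  neg-homo -[1+ n ]      = ≈-sym (-‿involutive _)

  ⊖-homo : ∀ m n → ⟦ m ℤ.⊖ n ⟧ℤ ≈ m ×′ 1# + - (n ×′ 1#)
  ⊖-homo m       zero    = ≈-sym (≈-trans (+-congˡ -0#≈0#) (+-identityʳ _))
  ⊖-homo zero    (suc n) = ≈-sym (+-identityˡ _)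
  ⊖-homo (suc m) (suc n) = begin
    ⟦ suc m ℤ.⊖ suc n ⟧ℤ                       ≡⟨ cong ⟦_⟧ℤ (ℤ.[1+m]⊖[1+n]≡m⊖n m n) ⟩
    ⟦ m ℤ.⊖ n ⟧ℤ                               ≈⟨ ⊖-homo m n ⟩
    m ×′ 1# + - (n ×′ 1#)                      ≈⟨ +-congʳ (+-identityʳ _) ⟨
    (m ×′ 1# + 0#) + - (n ×′ 1#)               ≈⟨ +-congʳ (+-congˡ (-‿inverseʳ 1#)) ⟨
    (m ×′ 1# + (1# + - 1#)) + - (n ×′ 1#)      ≈⟨ +-congʳ (+-assoc _ _ _) ⟨
    ((m ×′ 1# + 1#) + - 1#) + - (n ×′ 1#)      ≈⟨ +-assoc _ _ _ ⟩
    (m ×′ 1# + 1#) + (- 1# + - (n ×′ 1#))      ≈⟨ +-cong (+-comm _ _) (⁻¹-∙-comm _ _) ⟩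
    (1# + m ×′ 1#) + - (1# + n ×′ 1#)          ≈⟨ +-cong (1+× m 1#) (-‿cong (1+× n 1#)) ⟨
    suc m ×′ 1# + - (suc n ×′ 1#)              ∎

  +-homo : ∀ i j → ⟦ i ℤ.+ j ⟧ℤ ≈ ⟦ i ⟧ℤ + ⟦ j ⟧ℤ
  +-homo (pos m)  (pos n)  = ×-homo-+ 1# m n
  +-homo (pos m)  -[1+ n ] = ⊖-homo m (suc n)
  +-homo -[1+ m ] (pos n)  = ≈-trans (⊖-homo n (suc m)) (+-comm _ _)
  +-homo -[1+ m ] -[1+ n ] = begin
    - (suc (suc (m ℕ.+ n)) ×′ 1#)                  ≡⟨ cong (λ k → - (k ×′ 1#)) (ℕ.+-suc (suc m) n) ⟨
    - ((suc m ℕ.+ suc n) ×′ 1#)                    ≈⟨ -‿cong (×-homo-+ 1# (suc m) (suc n)) ⟩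
    - (suc m ×′ 1# + suc n ×′ 1#)                  ≈⟨ ⁻¹-∙-comm _ _ ⟨
    - (suc m ×′ 1#) + - (suc n ×′ 1#)              ∎

  *-homo-pos : ∀ m j → ⟦ pos m ℤ.* j ⟧ℤ ≈ m ×′ 1# * ⟦ j ⟧ℤ
  *-homo-pos m (pos n)  = ≈-trans (≈-reflexive (cong ⟦_⟧ℤ (sym (ℤ.pos-* m n)))) (×1-homo-* m n)
  *-homo-pos m -[1+ n ] = begin
    ⟦ pos m ℤ.* (ℤ.- (pos (suc n))) ⟧ℤ    ≡⟨ cong ⟦_⟧ℤ (ℤ.neg-distribʳ-* (pos m) (pos (suc n))) ⟨
    ⟦ ℤ.- (pos m ℤ.* (pos (suc n))) ⟧ℤ    ≈⟨ neg-homo (pos m ℤ.* (pos (suc n))) ⟩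
    - ⟦ pos m ℤ.* (pos (suc n)) ⟧ℤ        ≈⟨ -‿cong (*-homo-pos m (pos (suc n))) ⟩
    - (m ×′ 1# * (suc n ×′ 1#))       ≈⟨ -‿distribʳ-* _ _ ⟩
    m ×′ 1# * - (suc n ×′ 1#)         ∎

  *-homo : ∀ i j → ⟦ i ℤ.* j ⟧ℤ ≈ ⟦ i ⟧ℤ * ⟦ j ⟧ℤ
  *-homo (pos m)  j = *-homo-pos m j
  *-homo -[1+ m ] j = begin
    ⟦ (ℤ.- (pos (suc m))) ℤ.* j ⟧ℤ    ≡⟨ cong ⟦_⟧ℤ (ℤ.neg-distribˡ-* (pos (suc m)) j) ⟨
    ⟦ ℤ.- ((pos (suc m)) ℤ.* j) ⟧ℤ    ≈⟨ neg-homo ((pos (suc m)) ℤ.* j) ⟩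
    - ⟦ (pos (suc m)) ℤ.* j ⟧ℤ        ≈⟨ -‿cong (*-homo-pos (suc m) j) ⟩
    - (suc m ×′ 1# * ⟦ j ⟧ℤ)      ≈⟨ -‿distribˡ-* _ _ ⟩
    - (suc m ×′ 1#) * ⟦ j ⟧ℤ      ∎

  morphism : ℤ.+-*-rawRing -Raw-AlmostCommutative⟶ fromCommutativeRing R
  morphism = record
    { ⟦_⟧    = ⟦_⟧ℤ
    ; +-homo = +-homo
    ; *-homo = *-homo
    ; -‿homo = neg-homo
    ; 0-homo = ≈-refl
    ; 1-homo = ≈-refl
    }

  open import Algebra.Solver.Ring ℤ.+-*-rawRing (fromCommutativeRing R) morphism
    (λ i j → Maybe.map (λ eq → ≈-reflexive (cong ⟦_⟧ℤ eq)) (dec⇒maybe (i ℤ.≟ j))) public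
    using (Polynomial; solve; _:=_; _:+_; _:*_; _:-_; :-_; con)

  -- With the optimised multiple, `κ 1`, `κ 2` and `κ 3` evaluate definitionally to `1#`, `1# + 1#`
  -- and `1# + 1# + 1#`, so solved identities apply directly to `2#` and `3#`.
  κ : ∀ {n} → ℕ → Polynomial n
  κ c = con (pos c)

-- Arithmetic in the field.

module FieldTheory {q : ℕ} (𝔽 : FiniteField q) where
  open FiniteField 𝔽 public

  ring : CommutativeRing 0ℓ 0ℓ
  ring = record { isCommutativeRing = isCommutativeRing }

  open CommutativeRing ring public
    using (*-comm; *-assoc; *-identityˡ; *-identityʳ; zeroˡ; zeroʳ; +-identityˡ; +-identityʳ; -‿inverseʳ)
  open IntegerCoefficients ring public using (solve; _:=_; _:+_; _:*_; _:-_; :-_; κ)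

  2# 3# : Carrier
  2# = 1# + 1#
  3# = 1# + 1# + 1#


  x-y≡0⇒x≡y : ∀ {x y} → x - y ≡ 0# → x ≡ y
  x-y≡0⇒x≡y {x} {y} eq = trans (solve 2 (λ x y → x := (x :- y) :+ y) refl x y)
                               (trans (cong (_+ y) eq) (+-identityˡ y))

  x≡y⇒x-y≡0 : ∀ {x y} → x ≡ y → x - y ≡ 0#
  x≡y⇒x-y≡0 refl = -‿inverseʳ _

  x≢y⇒x-y≢0 : ∀ {x y} → x ≢ y → x - y ≢ 0#
  x≢y⇒x-y≢0 x≢y = x≢y ∘ x-y≡0⇒x≡y

  x*y≡0⇒y≡0 : ∀ {x y} → x ≢ 0# → x * y ≡ 0# → y ≡ 0#
  x*y≡0⇒y≡0 {x} {y} x≢0 xy≡0 = begin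
    y                ≡⟨ *-identityˡ y ⟨
    1# * y           ≡⟨ cong (_* y) (⁻¹-inverse x x≢0) ⟨
    x * x ⁻¹ * y     ≡⟨ solve 3 (λ x i y → x :* i :* y := i :* (x :* y)) refl x (x ⁻¹) y ⟩
    x ⁻¹ * (x * y)   ≡⟨ cong (x ⁻¹ *_) xy≡0 ⟩
    x ⁻¹ * 0#        ≡⟨ zeroʳ _ ⟩
    0#               ∎
    where open ≡-Reasoning

  *-≢0 : ∀ {x y} → x ≢ 0# → y ≢ 0# → x * y ≢ 0#
  *-≢0 x≢0 y≢0 = y≢0 ∘ x*y≡0⇒y≡0 x≢0

  *-cancelˡ : ∀ {x y z} → x ≢ 0# → x * y ≡ x * z → y ≡ z
  *-cancelˡ {x} {y} {z} x≢0 eq = x-y≡0⇒x≡y (x*y≡0⇒y≡0 x≢0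
    (trans (solve 3 (λ x y z → x :* (y :- z) := x :* y :- x :* z) refl x y z) (x≡y⇒x-y≡0 eq)))

  x*y≡1⇒x≢0 : ∀ {x y} → x * y ≡ 1# → x ≢ 0#
  x*y≡1⇒x≢0 {y = y} eq refl = 0≢1 (trans (sym (zeroˡ y)) eq)

  x*y≡1⇒x⁻¹≡y : ∀ {x y} → x * y ≡ 1# → x ⁻¹ ≡ y
  x*y≡1⇒x⁻¹≡y eq = *-cancelˡ x≢0 (trans (⁻¹-inverse _ x≢0) (sym eq))
    where x≢0 = x*y≡1⇒x≢0 eq

  ⁻¹-inverseˡ : ∀ {x} → x ≢ 0# → x ⁻¹ * x ≡ 1#
  ⁻¹-inverseˡ {x} x≢0 = trans (*-comm _ _) (⁻¹-inverse x x≢0)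

  ⁻¹-≢0 : ∀ {x} → x ≢ 0# → x ⁻¹ ≢ 0#
  ⁻¹-≢0 x≢0 = x*y≡1⇒x≢0 (⁻¹-inverseˡ x≢0)

  ⁻¹-involutive : ∀ {x} → x ≢ 0# → x ⁻¹ ⁻¹ ≡ x
  ⁻¹-involutive x≢0 = x*y≡1⇒x⁻¹≡y (⁻¹-inverseˡ x≢0)

  x/y≡z⇒x≡z*y : ∀ {x y z} → y ≢ 0# → x * y ⁻¹ ≡ z → x ≡ z * y
  x/y≡z⇒x≡z*y {x} {y} y≢0 refl = sym (trans (*-assoc _ _ _)
    (trans (cong (x *_) (⁻¹-inverseˡ y≢0)) (*-identityʳ x)))

  x≡z*y⇒x/y≡z : ∀ {x y z} → y ≢ 0# → x ≡ z * y → x * y ⁻¹ ≡ z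
  x≡z*y⇒x/y≡z {_} {y} {z} y≢0 refl = trans (*-assoc _ _ _)
    (trans (cong (z *_) (⁻¹-inverse y y≢0)) (*-identityʳ z))

  cross-multiply : ∀ {a b c d} → c ≢ 0# → d ≢ 0# → a * c ⁻¹ ≡ b * d ⁻¹ → a * d ≡ b * c
  cross-multiply {a} {b} {c} {d} c≢0 d≢0 eq = begin
    a * d                ≡⟨ cong (_* d) (x/y≡z⇒x≡z*y c≢0 eq) ⟩
    b * d ⁻¹ * c * d     ≡⟨ solve 4 (λ b i c d → b :* i :* c :* d := b :* c :* (i :* d)) refl b (d ⁻¹) c d ⟩
    b * c * (d ⁻¹ * d)   ≡⟨ cong (b * c *_) (⁻¹-inverseˡ d≢0) ⟩
    b * c * 1#           ≡⟨ *-identityʳ _ ⟩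
    b * c                ∎
    where open ≡-Reasoning

  x+1≢x : ∀ {x} → x + 1# ≢ x
  x+1≢x {x} eq = 0≢1 (sym (trans (solve 1 (λ x → κ 1 := (x :+ κ 1) :- x) refl x) (x≡y⇒x-y≡0 eq)))

  -- Enumeration of the field, products and Wilson's theorem.

  elements : List Carrier
  elements = map (Inverse.to enum) (allFin q)

  ∈-elements : ∀ x → x ∈ elements
  ∈-elements x = subst (_∈ elements) (Inverse.strictlyInverseˡ enum x)
                   (∈-map⁺ (Inverse.to enum) (∈-allFin (Inverse.from enum x)))

  elements-unique : Unique elements
  elements-unique = Unique.map⁺ (λ {i} {j} eq → trans (sym (Inverse.strictlyInverseʳ enum i))
    (trans (cong (Inverse.from enum) eq) (Inverse.strictlyInverseʳ enum j))) (Unique.allFin⁺ q)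

  length-elements : length elements ≡ q
  length-elements = trans (length-map _ (allFin q)) (length-tabulate {n = q} (λ i → i))

  -- Finiteness makes existence decidable, so the arguments by contradiction below yield actual
  -- witnesses.
  ∃? : {P : Carrier → Set} → (∀ x → Dec (P x)) → Dec (∃ P)
  ∃? P? with Any.any? P? elements
  ... | yes any = yes (Any.satisfied any)
  ... | no ¬any = no λ (x , px) → ¬any (lose (∈-elements x) px)

  prod : List Carrier → Carrier
  prod = foldr _*_ 1#

  prod-↭ : ∀ {xs ys} → xs ↭ ys → prod xs ≡ prod ys
  prod-↭ ↭.refl           = refl
  prod-↭ (↭.prep x p)     = cong (x *_) (prod-↭ p)
  prod-↭ (↭.swap x y p) = trans (cong (λ z → x * (y * z)) (prod-↭ p))
    (solve 3 (λ x y z → x :* (y :* z) := y :* (x :* z)) refl x y _)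
  prod-↭ (↭.trans p p′)   = trans (prod-↭ p) (prod-↭ p′)

  prod-map-* : ∀ (f g : Carrier → Carrier) xs →
               prod (map (λ x → f x * g x) xs) ≡ prod (map f xs) * prod (map g xs)
  prod-map-* f g []       = sym (*-identityˡ 1#)
  prod-map-* f g (x ∷ xs) = trans (cong (f x * g x *_) (prod-map-* f g xs))
    (solve 4 (λ a b c d → a :* b :* (c :* d) := a :* c :* (b :* d)) refl (f x) (g x) _ _)

  prod-pairs : ∀ M → (∀ {x} → x ∈ M → x ≢ 0#) → prod (concatMap (pair _⁻¹) M) ≡ 1#
  prod-pairs []      _   = refl
  prod-pairs (x ∷ M) M≢0 = begin
    x * (x ⁻¹ * prod (concatMap (pair _⁻¹) M))   ≡⟨ cong (λ z → x * (x ⁻¹ * z)) (prod-pairs M (M≢0 ∘ there)) ⟩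
    x * (x ⁻¹ * 1#)                              ≡⟨ cong (x *_) (*-identityʳ _) ⟩
    x * x ⁻¹                                     ≡⟨ ⁻¹-inverse x (M≢0 (here refl)) ⟩
    1#                                           ∎
    where open ≡-Reasoning

  nonzeros : Complement (0# ∷ []) elements
  nonzeros = complement ([] ∷ []) elements-unique (λ _ → ∈-elements _)

  open Complement nonzeros public using () renaming (rest to F*; unique to F*-unique)

  ∈-F*⁺ : ∀ {x} → x ≢ 0# → x ∈ F*
  ∈-F*⁺ x≢0 = Complement.∈-rest⁺ nonzeros (∈-elements _) λ { (here eq) → x≢0 eq }

  ∈-F*⁻ : ∀ {x} → x ∈ F* → x ≢ 0#
  ∈-F*⁻ x∈ refl = proj₂ (Complement.∈-rest⁻ nonzeros x∈) (here refl)

  -- Inversion pairs off every element other than 1 and -1.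
  wilson : 1# ≢ - 1# → prod F* ≡ - 1#
  wilson 1≢-1 = begin
    prod F*                                                ≡⟨ prod-↭ split ⟩
    1# * (- 1# * prod rest)                                ≡⟨ cong (λ z → 1# * (- 1# * z)) prod-rest ⟩
    1# * (- 1# * 1#)                                       ≡⟨ trans (*-identityˡ _) (*-identityʳ _) ⟩
    - 1#                                                   ∎
    where
    open ≡-Reasoning
    -1≢0 : - 1# ≢ 0#
    -1≢0 = x*y≡1⇒x≢0 {y = - 1#} (solve 0 (:- κ 1 :* (:- κ 1) := κ 1) refl)

    others : Complement (1# ∷ - 1# ∷ []) F*
    others = complement ((1≢-1 ∷ []) ∷ [] ∷ []) F*-unique
      λ { (here refl) → ∈-F*⁺ (0≢1 ∘ sym) ; (there (here refl)) → ∈-F*⁺ -1≢0 }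

    open Complement others

    rest≢0 : ∀ {x} → x ∈ rest → x ≢ 0#
    rest≢0 = ∈-F*⁻ ∘ proj₁ ∘ ∈-rest⁻

    root-of-one : ∀ {x} → x * x ≡ 1# → x ≢ 1# → x ≡ - 1#
    root-of-one {x} eq x≢1 = x-y≡0⇒x≡y (x*y≡0⇒y≡0 (x≢y⇒x-y≢0 x≢1)
      (trans (solve 1 (λ x → (x :- κ 1) :* (x :- (:- κ 1)) := x :* x :- κ 1) refl x) (x≡y⇒x-y≡0 eq)))

    ⁻¹-∉ : ∀ {x} → x ∈ rest → x ⁻¹ ∉ 1# ∷ - 1# ∷ []
    ⁻¹-∉ {x} x∈ (here eq) = proj₂ (∈-rest⁻ x∈) (here
      (trans (sym (*-identityʳ x)) (trans (cong (x *_) (sym eq)) (⁻¹-inverse x (rest≢0 x∈)))))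
    ⁻¹-∉ {x} x∈ (there (here eq)) = proj₂ (∈-rest⁻ x∈) (there (here
      (trans (solve 1 (λ x → x := :- (x :* :- κ 1)) refl x)
        (cong -_ (trans (cong (x *_) (sym eq)) (⁻¹-inverse x (rest≢0 x∈)))))))

    pairs : ∃ λ M → M ⊆ rest × rest ↭ concatMap (pair _⁻¹) M
    pairs = involution⇒pairs _⁻¹ unique
      (λ x∈ → ∈-rest⁺ (∈-F*⁺ (⁻¹-≢0 (rest≢0 x∈))) (⁻¹-∉ x∈))
      (⁻¹-involutive ∘ rest≢0)
      -- A fixed point of inversion satisfies x x = 1, so it is 1 or -1, and both were removed from
      -- `rest`.
      (λ {x} x∈ eq → proj₂ (∈-rest⁻ x∈) (there (here (root-of-one
         (trans (cong (x *_) (sym eq)) (⁻¹-inverse x (rest≢0 x∈)))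
         (λ x≡1 → proj₂ (∈-rest⁻ x∈) (here x≡1))))))

    prod-rest : prod rest ≡ 1#
    prod-rest = let M , M⊆ , p = pairs in trans (prod-↭ p) (prod-pairs M (rest≢0 ∘ M⊆))

  -- Such an `f` permutes F*, so it only reorders the factors.
  prod-map-F* : ∀ {f} → (∀ {x} → x ≢ 0# → f x ≢ 0#) →
                (∀ {x y} → x ≢ 0# → y ≢ 0# → f x ≡ f y → x ≡ y) → prod (map f F*) ≡ prod F*
  prod-map-F* f≢0 inj = prod-↭ (map-injective⇒↭ (λ x∈ y∈ → inj (∈-F*⁻ x∈) (∈-F*⁻ y∈)) F*-unique
                                  (∈-F*⁺ ∘ f≢0 ∘ ∈-F*⁻))

  -- Were the pointwise product injective, the product P of F* would satisfy P = P P.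
  collision : 1# ≢ - 1# → ∀ {f g} →
    (∀ {x} → x ≢ 0# → f x ≢ 0#) → (∀ {x y} → x ≢ 0# → y ≢ 0# → f x ≡ f y → x ≡ y) →
    (∀ {x} → x ≢ 0# → g x ≢ 0#) → (∀ {x y} → x ≢ 0# → y ≢ 0# → g x ≡ g y → x ≡ y) →
    ∃ λ x → ∃ λ y → x ≢ 0# × y ≢ 0# × x ≢ y × f x * g x ≡ f y * g y
  collision 1≢-1 {f} {g} f≢0 f-inj g≢0 g-inj
    with ∃? (λ x → ∃? (λ y → ¬? (x ≟ 0#) ×-dec ¬? (y ≟ 0#) ×-dec ¬? (x ≟ y) ×-dec ((f x * g x) ≟ (f y * g y))))
  ... | yes found = found
  ... | no ¬found = contradiction P≡1 P≢1
    where
    h : Carrier → Carrier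
    h x = f x * g x

    h-inj : ∀ {x y} → x ≢ 0# → y ≢ 0# → h x ≡ h y → x ≡ y
    h-inj {x} {y} x≢0 y≢0 eq with x ≟ y
    ... | yes x≡y = x≡y
    ... | no  x≢y = contradiction (x , y , x≢0 , y≢0 , x≢y , eq) ¬found

    P : Carrier
    P = prod F*

    P≡-1 : P ≡ - 1#
    P≡-1 = wilson 1≢-1

    P≢1 : P ≢ 1#
    P≢1 eq = 1≢-1 (trans (sym eq) P≡-1)

    P≡1 : P ≡ 1#
    P≡1 = begin
      P                                   ≡⟨ prod-map-F* (λ x≢0 → *-≢0 (f≢0 x≢0) (g≢0 x≢0)) h-inj ⟨
      prod (map h F*)                     ≡⟨ prod-map-* f g F* ⟩
      prod (map f F*) * prod (map g F*)   ≡⟨ cong₂ _*_ (prod-map-F* f≢0 f-inj) (prod-map-F* g≢0 g-inj) ⟩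
      P * P                               ≡⟨ cong₂ _*_ P≡-1 P≡-1 ⟩
      - 1# * - 1#                         ≡⟨ solve 0 (:- κ 1 :* (:- κ 1) := κ 1) refl ⟩
      1#                                  ∎
      where open ≡-Reasoning

  -- Polynomials, as coefficient lists with the constant term first, and their roots.

  eval : List Carrier → Carrier → Carrier
  eval []       x = 0#
  eval (a ∷ as) x = a + x * eval as x

  -- (a ∷ as) divided by X - r has quotient `quotient as r` (for any a).
  quotient : List Carrier → Carrier → List Carrier
  quotient []       r = []
  quotient (a ∷ as) r = eval (a ∷ as) r ∷ quotient as r

  length-quotient : ∀ as r → length (quotient as r) ≡ length as
  length-quotient []       r = refl
  length-quotient (a ∷ as) r = cong suc (length-quotient as r)

  eval-quotient : ∀ a as r x → eval (a ∷ as) x - eval (a ∷ as) r ≡ (x - r) * eval (quotient as r) x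
  eval-quotient a []       r x = solve 3 (λ a r x → (a :+ x :* κ 0) :- (a :+ r :* κ 0) := (x :- r) :* κ 0) refl a r x
  eval-quotient a (b ∷ bs) r x = begin
    (a + x * e x) - (a + r * e r)
      ≡⟨ solve 5 (λ a r x u v → (a :+ x :* u) :- (a :+ r :* v) := (x :- r) :* v :+ x :* (u :- v))
           refl a r x (e x) (e r) ⟩
    (x - r) * e r + x * (e x - e r)
      ≡⟨ cong (λ z → (x - r) * e r + x * z) (eval-quotient b bs r x) ⟩
    (x - r) * e r + x * ((x - r) * eval (quotient bs r) x)
      ≡⟨ solve 4 (λ r x v w → (x :- r) :* v :+ x :* ((x :- r) :* w) := (x :- r) :* (v :+ x :* w))
           refl r x (e r) _ ⟩
    (x - r) * (e r + x * eval (quotient bs r) x) ∎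
    where
    open ≡-Reasoning
    e : Carrier → Carrier
    e = eval (b ∷ bs)

  eval-zero : ∀ {as} x → All (_≡ 0#) as → eval as x ≡ 0#
  eval-zero x []          = refl
  eval-zero x (refl ∷ zs) = trans (+-identityˡ _) (trans (cong (x *_) (eval-zero x zs)) (zeroʳ x))

  head≡0 : ∀ {a as r} → All (_≡ 0#) as → eval (a ∷ as) r ≡ 0# → a ≡ 0#
  head≡0 {a} {r = r} zs eq = trans (sym (trans (cong (λ z → a + r * z) (eval-zero r zs))
    (trans (cong (_+_ a) (zeroʳ r)) (+-identityʳ a)))) eq

  -- The coefficients of the quotient are the values at `r` of the successive suffixes of `as`.
  -- Starting from the shortest suffix, each vanishing value makes one more coefficient vanish.
  quotient-zero : ∀ as r → All (_≡ 0#) (quotient as r) → All (_≡ 0#) as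
  quotient-zero []       r []       = []
  quotient-zero (a ∷ as) r (z ∷ zs) = head≡0 {r = r} as≡0 z ∷ as≡0
    where as≡0 = quotient-zero as r zs

  -- Induction on the degree: after division by X - r the other roots remain roots of the quotient.
  -- A list of length n + 1 has degree at most n, so the length condition says that the roots
  -- outnumber the degree.
  many-roots⇒zero : ∀ as {xs} → Unique xs → All (λ x → eval as x ≡ 0#) xs →
                    length as ℕ.≤ length xs → All (_≡ 0#) as
  many-roots⇒zero []       _        _          _    = []
  many-roots⇒zero (a ∷ as) {r ∷ xs} (r∉ ∷ u) (er ∷ es) (s≤s len) = head≡0 {r = r} as≡0 er ∷ as≡0
    where
    root : ∀ {x} → x ∈ xs → eval (quotient as r) x ≡ 0#
    root {x} x∈ = x*y≡0⇒y≡0 (x≢y⇒x-y≢0 (λ x≡r → All.lookup r∉ x∈ (sym x≡r)))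
      (trans (sym (eval-quotient a as r x)) (x≡y⇒x-y≡0 (trans (All.lookup es x∈) (sym er))))
    as≡0 : All (_≡ 0#) as
    as≡0 = quotient-zero as r (many-roots⇒zero (quotient as r) u (All.tabulate root)
             (subst (ℕ._≤ length xs) (sym (length-quotient as r)) len))

  -- Consequences of q ≡ 1 mod 6: odd characteristic, a square root of -3, a nonsquare.

  module _ (q≡1[6] : q % 6 ≡ 1) where

    q≡1+6k : ∃ λ k → q ≡ 1 ℕ.+ k ℕ.* 6
    q≡1+6k = q / 6 , trans (m≡m%n+[m/n]*n q 6) (cong (ℕ._+ (q / 6) ℕ.* 6) q≡1[6])

    -- Translation by 1 would be a fixed-point-free involution of F.
    2≢0 : 2# ≢ 0#
    2≢0 2≡0 = contradiction (∣1⇒≡1 2∣1) λ ()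
      where
      2∣q : 2 ∣ q
      2∣q =
        let M , _ , p = involution⇒pairs (_+ 1#) elements-unique (λ _ → ∈-elements _)
                          (λ {x} _ → trans (solve 1 (λ x → x :+ κ 1 :+ κ 1 := x :+ κ 2) refl x)
                                       (trans (cong (x +_) 2≡0) (+-identityʳ x)))
                          (λ _ → x+1≢x)
        in divides (length M)
             (trans (sym length-elements) (trans (↭-length p) (length-concatMap _ 2 (λ _ → refl) M)))

      2∣1 : 2 ∣ 1
      2∣1 = let k , eq = q≡1+6k in
        ∣m+n∣m⇒∣n (subst (2 ∣_) (trans eq (ℕ.+-comm 1 _)) 2∣q) (∣-trans (divides 3 refl) (n∣m*n k {6}))

    1≢-1 : 1# ≢ - 1#
    1≢-1 eq = 2≢0 (trans (cong (1# +_) eq) (-‿inverseʳ 1#))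

    -- x ↦ 1/(1-x) has order 3 on F minus {0,1}, a set of size ≡ 2 mod 3; its
    -- fixed points are the primitive sixth roots of unity.
    sixth-root : ∃ λ x → x * x - x + 1# ≡ 0#
    sixth-root with ∃? (λ x → (x * x - x + 1#) ≟ 0#)
    ... | yes found = found
    ... | no ¬found = contradiction (∣1⇒≡1 3∣1) λ ()
      where
      others : Complement (0# ∷ 1# ∷ []) elements
      others = complement ((0≢1 ∷ []) ∷ [] ∷ []) elements-unique (λ _ → ∈-elements _)

      open Complement others

      t : Carrier → Carrier
      t x = (1# - x) ⁻¹

      1-x≢0 : ∀ {x} → x ∈ rest → 1# - x ≢ 0#
      1-x≢0 x∈ 1-x≡0 = proj₂ (∈-rest⁻ x∈) (there (here (sym (x-y≡0⇒x≡y 1-x≡0))))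

      t-∉ : ∀ {x} → x ∈ rest → t x ∉ 0# ∷ 1# ∷ []
      t-∉ x∈ (here tx≡0) = ⁻¹-≢0 (1-x≢0 x∈) tx≡0
      t-∉ {x} x∈ (there (here tx≡1)) = proj₂ (∈-rest⁻ x∈) (here (begin
        x                        ≡⟨ solve 1 (λ x → x := κ 1 :- (κ 1 :- x) :* κ 1) refl x ⟩
        1# - (1# - x) * 1#       ≡⟨ cong (λ z → 1# - (1# - x) * z) tx≡1 ⟨
        1# - (1# - x) * t x      ≡⟨ cong (_-_ 1#) (⁻¹-inverse _ (1-x≢0 x∈)) ⟩
        1# - 1#                  ≡⟨ -‿inverseʳ 1# ⟩
        0#                       ∎))
        where open ≡-Reasoning

      t∈ : ∀ {x} → x ∈ rest → t x ∈ rest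
      t∈ x∈ = ∈-rest⁺ (∈-elements _) (t-∉ x∈)

      t³≡id : ∀ {x} → x ∈ rest → t (t (t x)) ≡ x
      t³≡id {x} x∈ = x*y≡1⇒x⁻¹≡y (begin
        (1# - w) * x
          -- The difference to 1 is written as a combination of the two defining relations (1 - u) w
          -- = 1 and (1 - x) u = 1.
          ≡⟨ solve 3 (λ x u w → (κ 1 :- w) :* x :=
               κ 1 :+ ((κ 1 :- u) :* w :- κ 1) :* (κ 1 :- x)
                         :+ w :* ((κ 1 :- x) :* u :- κ 1)) refl x u w ⟩
        1# + ((1# - u) * w - 1#) * (1# - x) + w * ((1# - x) * u - 1#)
          ≡⟨ cong₂ (λ a b → 1# + (a - 1#) * (1# - x) + w * (b - 1#))
               (⁻¹-inverse _ (1-x≢0 (t∈ x∈))) (⁻¹-inverse _ (1-x≢0 x∈)) ⟩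
        1# + (1# - 1#) * (1# - x) + w * (1# - 1#)
          ≡⟨ solve 2 (λ x w → κ 1 :+ (κ 1 :- κ 1) :* (κ 1 :- x)
                         :+ w :* (κ 1 :- κ 1) := κ 1) refl x w ⟩
        1# ∎)
        where
        open ≡-Reasoning
        u w : Carrier
        u = t x
        w = t u

      t≢ : ∀ {x} → x ∈ rest → t x ≢ x
      t≢ {x} x∈ tx≡x = ¬found (x , (begin
        x * x - x + 1#           ≡⟨ solve 1 (λ x → x :* x :- x :+ κ 1 := κ 1 :- (κ 1 :- x) :* x) refl x ⟩
        1# - (1# - x) * x        ≡⟨ cong (λ z → 1# - (1# - x) * z) tx≡x ⟨
        1# - (1# - x) * t x      ≡⟨ cong (_-_ 1#) (⁻¹-inverse _ (1-x≢0 x∈)) ⟩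
        1# - 1#                  ≡⟨ -‿inverseʳ 1# ⟩
        0#                       ∎))
        where open ≡-Reasoning

      3∣rest : 3 ∣ length rest
      3∣rest = let M , _ , p = order3⇒triples t unique t∈ t³≡id t≢ in
        divides (length M) (trans (↭-length p) (length-concatMap _ 3 (λ _ → refl) M))

      -- Counting the field in two ways gives 2 + |rest| = q = 1 + 6k, hence |rest| + 1 = 6k.
      3∣1+rest : 3 ∣ length rest ℕ.+ 1
      3∣1+rest = let k , eq = q≡1+6k in subst (3 ∣_)
        (trans (ℕ.suc-injective (trans (sym eq) (trans (sym length-elements) (↭-length split)))) (ℕ.+-comm 1 _))
        (∣-trans (divides 2 refl) (n∣m*n k {6}))

      3∣1 : 3 ∣ 1
      3∣1 = ∣m+n∣m⇒∣n 3∣1+rest 3∣rest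

    -- -3 is the discriminant of X² - X + 1; completing the square at a root x gives (2x - 1)² =
    -- 4(x² - x + 1) - 3.
    √-3 : ∃ λ s → s * s ≡ - 3#
    √-3 with sixth-root
    ... | x , eq = 2# * x - 1# , (begin
      (2# * x - 1#) * (2# * x - 1#)
        ≡⟨ solve 1 (λ x → (κ 2 :* x :- κ 1) :* (κ 2 :* x :- κ 1)
             := κ 2 :* κ 2 :* (x :* x :- x :+ κ 1) :- κ 3) refl x ⟩
      2# * 2# * (x * x - x + 1#) - 3#  ≡⟨ cong (λ z → 2# * 2# * z - 3#) eq ⟩
      2# * 2# * 0# - 3#                ≡⟨ cong (_- 3#) (zeroʳ _) ⟩
      0# - 3#                          ≡⟨ +-identityˡ _ ⟩
      - 3#                             ∎)
      where open ≡-Reasoning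

    -- If every element were a square, a choice of roots `√` would be injective, hence bijective,
    -- with squaring as its inverse. But 1 and -1 have the same square.
    nonsquare : ∃ λ ε → ∀ x → x * x ≢ ε
    nonsquare with ∃? (λ ε → ¬? (∃? (λ x → (x * x) ≟ ε)))
    ... | yes (ε , ¬sq) = ε , λ x eq → ¬sq (x , eq)
    ... | no ¬found = contradiction 1≡-1 1≢-1
      where
      root : ∀ ε → ∃ λ x → x * x ≡ ε
      root ε = decidable-stable (∃? _≟ε) (λ ¬sq → ¬found (ε , ¬sq))
        where
        _≟ε : ∀ x → Dec (x * x ≡ ε)
        x ≟ε = (x * x) ≟ ε

      √ : Carrier → Carrier
      √ = proj₁ ∘ root

      √² : ∀ ε → √ ε * √ ε ≡ ε
      √² = proj₂ ∘ root

      √-perm = injective⇒↔ elements-unique ∈-elements √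
        (λ {x} {y} eq → trans (sym (√² x)) (trans (cong₂ _*_ eq eq) (√² y)))

      open Inverse (proj₁ √-perm) using (from; strictlyInverseˡ)

      √-from : ∀ x → √ (from x) ≡ x
      √-from x = trans (sym (proj₂ √-perm (from x))) (strictlyInverseˡ x)

      from-square : ∀ x → from x ≡ x * x
      from-square x = trans (sym (√² (from x))) (cong₂ _*_ (√-from x) (√-from x))

      1≡-1 : 1# ≡ - 1#
      1≡-1 = trans (sym (√-from 1#)) (trans (cong √ (trans (from-square 1#)
        (trans (solve 0 (κ 1 :* κ 1 := (:- κ 1) :* (:- κ 1)) refl) (sym (from-square (- 1#))))))
        (√-from (- 1#)))

-- Möbius maps as permutations of the projective line.

module Covering {q : ℕ} (𝔽 : FiniteField q) where
  open FieldTheory 𝔽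
  open ProjectiveLine 𝔽
  open Inverse using (to; from; strictlyInverseˡ; strictlyInverseʳ)

  points≡ : points ≡ nothing ∷ map just elements
  points≡ = cong (nothing ∷_) (map-∘ (allFin q))

  points-unique : Unique points
  points-unique = subst Unique (sym points≡)
    (All.map⁺ (All.tabulate (λ _ ())) ∷ Unique.map⁺ just-injective elements-unique)

  ∈-points : ∀ x → x ∈ points
  ∈-points nothing  = here refl
  ∈-points (just x) = subst (just x ∈_) (sym points≡) (there (∈-map⁺ just (∈-elements x)))

  to-injective : ∀ (g : Perm P¹) {x y} → to g x ≡ to g y → x ≡ y
  to-injective g {x} {y} eq =
    trans (sym (strictlyInverseʳ g x)) (trans (cong (from g) eq) (strictlyInverseʳ g y))

  from-injective : ∀ (g : Perm P¹) {x y} → from g x ≡ from g y → x ≡ y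
  from-injective g {x} {y} eq =
    trans (sym (strictlyInverseˡ g x)) (trans (cong (to g) eq) (strictlyInverseˡ g y))

  module _ {a b c d : Carrier} where

    möbius-∞↦∞ : c ≡ 0# → möbius a b c d nothing ≡ nothing
    möbius-∞↦∞ c≡0 with c ≟ 0#
    ... | yes _   = refl
    ... | no  c≢0 = contradiction c≡0 c≢0

    möbius-∞↦just : c ≢ 0# → möbius a b c d nothing ≡ just (a * c ⁻¹)
    möbius-∞↦just c≢0 with c ≟ 0#
    ... | yes c≡0 = contradiction c≡0 c≢0
    ... | no  _   = refl

    möbius-pole : ∀ {x} → c * x + d ≡ 0# → möbius a b c d (just x) ≡ nothing
    möbius-pole {x} eq with (c * x + d) ≟ 0#
    ... | yes _  = refl
    ... | no  ≢0 = contradiction eq ≢0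

    möbius-just : ∀ {x y} → c * x + d ≢ 0# → a * x + b ≡ y * (c * x + d) →
                  möbius a b c d (just x) ≡ just y
    möbius-just {x} ≢0 eq with (c * x + d) ≟ 0#
    ... | yes ≡0 = contradiction ≡0 ≢0
    ... | no  _  = cong just (x≡z*y⇒x/y≡z ≢0 eq)

    -- The source of injectivity: the cross difference of the fractions at x and y is the
    -- determinant times x - y. `det-∞` is the analogue with ∞ in place of one of the points.
    det-cross : ∀ x y → (a * x + b) * (c * y + d) ≡ (a * y + b) * (c * x + d) →
                (a * d - b * c) * (x - y) ≡ 0#
    det-cross x y eq = trans
      (solve 6 (λ a b c d x y → (a :* d :- b :* c) :* (x :- y) :=
         (a :* x :+ b) :* (c :* y :+ d) :- (a :* y :+ b) :* (c :* x :+ d)) refl a b c d x y)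
      (x≡y⇒x-y≡0 eq)

    det-∞ : ∀ x → a * (c * x + d) ≡ (a * x + b) * c → a * d - b * c ≡ 0#
    det-∞ x eq = trans
      (solve 5 (λ a b c d x → a :* d :- b :* c := a :* (c :* x :+ d) :- (a :* x :+ b) :* c) refl a b c d x)
      (x≡y⇒x-y≡0 eq)

    möbius-∞-just : ∀ x → möbius a b c d nothing ≡ möbius a b c d (just x) → a * d - b * c ≡ 0#
    möbius-∞-just x eq with c ≟ 0# | (c * x + d) ≟ 0#
    ... | yes c≡0 | yes ≡0 = det-∞ x (trans (trans (cong (a *_) ≡0) (zeroʳ a))
                                       (sym (trans (cong ((a * x + b) *_) c≡0) (zeroʳ _))))
    ... | no  c≢0 | no  ≢0 = det-∞ x (cross-multiply c≢0 ≢0 (just-injective eq))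

    möbius-injective : a * d - b * c ≢ 0# → ∀ {x y} → möbius a b c d x ≡ möbius a b c d y → x ≡ y
    möbius-injective det≢0 {nothing} {nothing} _  = refl
    möbius-injective det≢0 {nothing} {just y}  eq = contradiction (möbius-∞-just y eq) det≢0
    möbius-injective det≢0 {just x}  {nothing} eq = contradiction (möbius-∞-just x (sym eq)) det≢0
    möbius-injective det≢0 {just x}  {just y}  eq =
      cong just (x-y≡0⇒x≡y (x*y≡0⇒y≡0 det≢0 (det-cross x y (cross eq))))
      where
      cross : möbius a b c d (just x) ≡ möbius a b c d (just y) →
              (a * x + b) * (c * y + d) ≡ (a * y + b) * (c * x + d)
      cross eq with (c * x + d) ≟ 0# | (c * y + d) ≟ 0#
      ... | yes x≡0 | yes y≡0 = trans (trans (cong ((a * x + b) *_) y≡0) (zeroʳ _))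
                                      (sym (trans (cong ((a * y + b) *_) x≡0) (zeroʳ _)))
      ... | no  x≢0 | no  y≢0 = cross-multiply x≢0 y≢0 (just-injective eq)

  möbius-perm : ∀ {a b c d} → a * d - b * c ≢ 0# →
                Σ (Perm P¹) λ g → ∀ x → to g x ≡ möbius a b c d x
  möbius-perm det≢0 = injective⇒↔ points-unique ∈-points _ (möbius-injective det≢0)

  -- Distances, their minimum over the group, and agreements.

  fixed? : ∀ (v g : Perm P¹) x → Dec (to v (from g x) ≡ x)
  fixed? v g x = to v (from g x) ≟P x

  -- `dist` uses the inverse stored in a permutation, while `InPGL₂` speaks of the forward map only;
  -- the forward map determines the inverse.
  dist-cong : ∀ (v g h : Perm P¹) → (∀ x → to g x ≡ to h x) → dist v g ≡ dist v h
  dist-cong v g h eq = cong (λ xs → suc q ℕ.∸ length xs) (filter-≐ (fixed? v g) (fixed? v h)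
    ((λ {x} → trans (cong (to v) (sym (from-eq x)))) , (λ {x} → trans (cong (to v) (from-eq x)))) points)
    where
    from-eq : ∀ x → from g x ≡ from h x
    from-eq x = to-injective h (trans (sym (eq (from g x)))
                  (trans (strictlyInverseˡ g x) (sym (strictlyInverseˡ h x))))

  Quadruple : Set
  Quadruple = Carrier × Carrier × Carrier × Carrier

  quadruples : List Quadruple
  quadruples = cartesianProduct elements (cartesianProduct elements (cartesianProduct elements elements))

  ∈-quadruples : ∀ t → t ∈ quadruples
  ∈-quadruples (a , b , c , d) = ∈-cartesianProduct⁺ (∈-elements a)
    (∈-cartesianProduct⁺ (∈-elements b) (∈-cartesianProduct⁺ (∈-elements c) (∈-elements d)))

  1*1-0*0≢0 : 1# * 1# - 0# * 0# ≢ 0#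
  1*1-0*0≢0 eq = 0≢1 (sym (trans (solve 0 (κ 1 := κ 1 :* κ 1 :- κ 0 :* κ 0) refl) eq))

  -- Singular matrices are sent to the identity.
  toPGL₂ : Quadruple → Σ (Perm P¹) InPGL₂
  toPGL₂ (a , b , c , d) with (a * d - b * c) ≟ 0#
  ... | yes _     = proj₁ (möbius-perm 1*1-0*0≢0) , 1# , 0# , 0# , 1# , 1*1-0*0≢0 , proj₂ (möbius-perm 1*1-0*0≢0)
  ... | no  det≢0 = proj₁ (möbius-perm det≢0) , a , b , c , d , det≢0 , proj₂ (möbius-perm det≢0)

  toPGL₂-möbius : ∀ {a b c d} → a * d - b * c ≢ 0# →
                  ∀ x → to (proj₁ (toPGL₂ (a , b , c , d))) x ≡ möbius a b c d x
  toPGL₂-möbius {a} {b} {c} {d} det≢0 x with (a * d - b * c) ≟ 0#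
  ... | yes det≡0 = contradiction det≡0 det≢0
  ... | no  det≢0 = proj₂ (möbius-perm det≢0) x

  -- The minimum is taken over the finite list of all coefficient quadruples. Every member of the
  -- group is at the same distance from `v` as the entry with its coefficients.
  distToPGL₂ : ∀ v → ∃ λ s → DistToSetIs InPGL₂ v s
  distToPGL₂ v = f best , (proj₁ (toPGL₂ best) , proj₂ (toPGL₂ best) , refl) , minimal
    where
    f : Quadruple → ℕ
    f t = dist v (proj₁ (toPGL₂ t))

    best : Quadruple
    -- The default is the identity matrix, which also occurs in the list.
    best = argmin f (1# , 0# , 0# , 1#) quadruples

    minimal : ∀ g → InPGL₂ g → f best ℕ.≤ dist v g
    minimal g (a , b , c , d , det≢0 , g≡) = subst (f best ℕ.≤_)
      (dist-cong v (proj₁ (toPGL₂ (a , b , c , d))) g (λ x → trans (toPGL₂-möbius det≢0 x) (sym (g≡ x))))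
      (All.lookup (f[argmin]≤f[xs] {f = f} _ quadruples) (∈-quadruples (a , b , c , d)))

  -- `v` and `g` agree at x exactly when g x is a fixed point of v g⁻¹. Here `to g` carries
  -- agreements to fixed points; in `fix≤agreements`, `from g` carries them back.
  agreements≤fix : ∀ (v g : Perm P¹) {L} → Unique L → All (λ x → to v x ≡ to g x) L →
                   length L ℕ.≤ length (fix (λ x → to v (from g x)))
  agreements≤fix v g {L} u agree = subst (ℕ._≤ _) (length-map (to g) L)
    (unique-⊆⇒length≤ (Unique.map⁺ (to-injective g) u) ⊆fix)
    where
    ⊆fix : map (to g) L ⊆ fix (λ x → to v (from g x))
    ⊆fix y∈ with ∈-map⁻ (to g) y∈
    ... | x , x∈ , refl = ∈-filter⁺ (fixed? v g) (∈-points _)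
      (trans (cong (to v) (strictlyInverseʳ g x)) (All.lookup agree x∈))

  fix≤agreements : ∀ (v g : Perm P¹) k →
                   (∀ {L} → Unique L → All (λ x → to v x ≡ to g x) L → length L ℕ.≤ k) →
                   length (fix (λ x → to v (from g x))) ℕ.≤ k
  fix≤agreements v g k bound = subst (ℕ._≤ k) (length-map (from g) fixed)
    (bound (Unique.map⁺ (from-injective g) (Unique.filter⁺ (fixed? v g) points-unique))
      (All.map⁺ (All.tabulate agree)))
    where
    fixed : List P¹
    fixed = fix (λ x → to v (from g x))

    agree : ∀ {x} → x ∈ fixed → to v (from g x) ≡ to g (from g x)
    agree {x} x∈ = trans (proj₂ (∈-filter⁻ (fixed? v g) {xs = points} x∈)) (sym (strictlyInverseˡ g x))

  -- Upper bound: a Möbius map that agrees with v in four points.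

  FourAgreements : Perm P¹ → Set
  FourAgreements v = ∃ λ g → InPGL₂ g × ∃ λ L → Unique L × All (λ x → to v x ≡ to g x) L × length L ≡ 4

  fourAgreements-möbius : ∀ v {a b c d} → a * d - b * c ≢ 0# → ∀ {L} → Unique L →
                          All (λ x → to v x ≡ möbius a b c d x) L → length L ≡ 4 → FourAgreements v
  fourAgreements-möbius v det≢0 u agree len with möbius-perm det≢0
  ... | g , g≡ = g , (_ , _ , _ , _ , det≢0 , g≡) , _ , u , All.map (λ eq → trans eq (sym (g≡ _))) agree , len

  module _ (1≢-1 : 1# ≢ - 1#) (v : Perm P¹) (v∞ : to v nothing ≡ nothing) where
    private
      -- `u` is `v` on the finite points; the default `0#` is never taken because `v` reaches ∞ only
      -- from ∞. `f` is `u` shifted so that 0 goes to 0.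
      u f : Carrier → Carrier
      u x = Maybe.fromMaybe 0# (to v (just x))
      f x = u x - u 0#

      v≡u : ∀ x → to v (just x) ≡ just (u x)
      v≡u x with to v (just x) in eq
      ... | just y  = refl
      ... | nothing = contradiction (to-injective v (trans eq (sym v∞))) λ ()

      f-inj : ∀ {x y} → f x ≡ f y → x ≡ y
      f-inj {x} {y} eq = just-injective (to-injective v (trans (v≡u x) (trans (cong just u≡) (sym (v≡u y)))))
        where
        u≡ : u x ≡ u y
        u≡ = x-y≡0⇒x≡y (trans
          (solve 3 (λ a b c → a :- b := (a :- c) :- (b :- c)) refl (u x) (u y) (u 0#)) (x≡y⇒x-y≡0 eq))

      f≢0 : ∀ {x} → x ≢ 0# → f x ≢ 0#
      f≢0 x≢0 fx≡0 = x≢0 (f-inj (trans fx≡0 (sym (-‿inverseʳ _))))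

      agree : ∀ γ x → f x ≡ γ * x → to v (just x) ≡ möbius γ (u 0#) 0# 1# (just x)
      agree γ x eq = trans (v≡u x) (sym (möbius-just denominator≢0 (begin
        γ * x + u 0#            ≡⟨ cong (_+ u 0#) eq ⟨
        u x - u 0# + u 0#       ≡⟨ solve 3 (λ a b x → a :- b :+ b := a :* (κ 0 :* x :+ κ 1)) refl (u x) (u 0#) x ⟩
        u x * (0# * x + 1#)     ∎)))
        where
        open ≡-Reasoning
        denominator≢0 : 0# * x + 1# ≢ 0#
        denominator≢0 eq′ = 0≢1 (sym (trans (solve 1 (λ x → κ 1 := κ 0 :* x :+ κ 1) refl x) eq′))

    -- The slope f x / x is the γ for which γX + `u 0#` passes through the value of `v` at x.
    -- `collision` with inversion as second factor finds two points of equal slope, and γ is also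
    -- the determinant.
    fourAgreements-∞↦∞ : FourAgreements v
    fourAgreements-∞↦∞ =
      let x , y , x≢0 , y≢0 , x≢y , γ≡ = collision 1≢-1 {f} {_⁻¹} f≢0 (λ _ _ → f-inj) ⁻¹-≢0
            (λ x≢0 y≢0 eq → trans (sym (⁻¹-involutive x≢0)) (trans (cong _⁻¹ eq) (⁻¹-involutive y≢0)))
          γ = f x * x ⁻¹
          det≢0 = λ eq → *-≢0 (f≢0 x≢0) (⁻¹-≢0 x≢0)
            (trans (solve 2 (λ γ b → γ := γ :* κ 1 :- b :* κ 0) refl γ (u 0#)) eq)
      in fourAgreements-möbius v det≢0 {nothing ∷ just 0# ∷ just x ∷ just y ∷ []}
           (((λ ()) ∷ (λ ()) ∷ (λ ()) ∷ []) ∷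
            ((x≢0 ∘ sym ∘ just-injective) ∷ (y≢0 ∘ sym ∘ just-injective) ∷ []) ∷
            ((x≢y ∘ just-injective) ∷ []) ∷ [] ∷ [])
           (trans v∞ (sym (möbius-∞↦∞ {b = u 0#} {d = 1#} refl)) ∷
            agree γ 0# (trans (-‿inverseʳ _) (sym (zeroʳ γ))) ∷
            agree γ x (x/y≡z⇒x≡z*y x≢0 refl) ∷
            agree γ y (x/y≡z⇒x≡z*y y≢0 (sym γ≡)) ∷ [])
           refl

  module _ (1≢-1 : 1# ≢ - 1#) (v : Perm P¹) {p x₀ : Carrier}
           (v∞ : to v nothing ≡ just p) (vx₀ : to v (just x₀) ≡ nothing) where
    private
      -- The coordinate is shifted so that the point sent to ∞ becomes 0, and the values so that `p`
      -- becomes 0. The default is taken only at x = 0, which all uses exclude.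
      f : Carrier → Carrier
      f x = Maybe.fromMaybe 0# (to v (just (x + x₀))) - p

      +x₀-inj : ∀ {x y} → x + x₀ ≡ y + x₀ → x ≡ y
      +x₀-inj {x} {y} eq = x-y≡0⇒x≡y (trans
        (solve 3 (λ x y z → x :- y := (x :+ z) :- (y :+ z)) refl x y x₀) (x≡y⇒x-y≡0 eq))

      v≡f : ∀ {x} → x ≢ 0# → to v (just (x + x₀)) ≡ just (f x + p)
      v≡f {x} x≢0 with to v (just (x + x₀)) in eq
      ... | just y  = cong just (solve 2 (λ y p → y := y :- p :+ p) refl y p)
      ... | nothing = contradiction
        (+x₀-inj (trans (just-injective (to-injective v (trans eq (sym vx₀)))) (sym (+-identityˡ x₀)))) x≢0

      f-inj : ∀ {x y} → x ≢ 0# → y ≢ 0# → f x ≡ f y → x ≡ y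
      f-inj x≢0 y≢0 eq = +x₀-inj (just-injective (to-injective v
        (trans (v≡f x≢0) (trans (cong (λ z → just (z + p)) eq) (sym (v≡f y≢0))))))

      f≢0 : ∀ {x} → x ≢ 0# → f x ≢ 0#
      f≢0 {x} x≢0 fx≡0 = contradiction
        (to-injective v {just (x + x₀)} {nothing} (trans (v≡f x≢0)
          (trans (cong just (trans (cong (_+ p) fx≡0) (+-identityˡ p))) (sym v∞)))) λ ()

      -- The matrix is that of p + γ/(X - x₀) over a common denominator; its determinant is -γ.
      agree : ∀ γ x → x ≢ 0# → f x * x ≡ γ →
              to v (just (x + x₀)) ≡ möbius p (γ - p * x₀) 1# (- x₀) (just (x + x₀))
      agree _ x x≢0 refl = trans (v≡f x≢0) (sym (möbius-just
        (λ eq → x≢0 (trans (solve 2 (λ x z → x := κ 1 :* (x :+ z) :+ :- z) refl x x₀) eq))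
        (solve 4 (λ x z p y → p :* (x :+ z) :+ (y :* x :- p :* z) := (y :+ p) :* (κ 1 :* (x :+ z) :+ :- z))
           refl x x₀ p (f x))))

    fourAgreements-∞↦just : FourAgreements v
    fourAgreements-∞↦just =
      -- In the shifted coordinate p + γ/x equals f x + p exactly when γ = f x * x, so the second
      -- factor is the identity.
      let x , y , x≢0 , y≢0 , x≢y , γ≡ = collision 1≢-1 {f} {λ x → x} f≢0 f-inj (λ x≢0 → x≢0) (λ _ _ eq → eq)
          γ = f x * x
          det≢0 = λ eq → *-≢0 (f≢0 x≢0) x≢0 (trans
            (solve 3 (λ γ p z → γ := :- (p :* :- z :- (γ :- p :* z) :* κ 1)) refl γ p x₀)
            (trans (cong -_ eq) (solve 0 (:- κ 0 := κ 0) refl)))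
          x₀≢ = λ {z} (z≢0 : z ≢ 0#) eq →
            z≢0 (+x₀-inj (sym (trans (+-identityˡ x₀) (just-injective {x = x₀} {y = z + x₀} eq))))
      in fourAgreements-möbius v det≢0 {nothing ∷ just x₀ ∷ just (x + x₀) ∷ just (y + x₀) ∷ []}
           (((λ ()) ∷ (λ ()) ∷ (λ ()) ∷ []) ∷
            (x₀≢ x≢0 ∷ x₀≢ y≢0 ∷ []) ∷
            ((x≢y ∘ +x₀-inj ∘ just-injective) ∷ []) ∷ [] ∷ [])
           (trans v∞ (sym (trans (möbius-∞↦just {b = γ - p * x₀} {d = - x₀} (0≢1 ∘ sym))
              (cong just (x≡z*y⇒x/y≡z (0≢1 ∘ sym) (sym (*-identityʳ p)))))) ∷
            trans vx₀ (sym (möbius-pole (solve 1 (λ z → κ 1 :* z :+ :- z := κ 0) refl x₀))) ∷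
            agree γ x x≢0 refl ∷
            agree γ y y≢0 (sym γ≡) ∷ [])
           refl

  fourAgreements : 1# ≢ - 1# → ∀ v → FourAgreements v
  fourAgreements 1≢-1 v with to v nothing in v∞ | from v nothing in v⁻¹∞
  ... | nothing | _       = fourAgreements-∞↦∞ 1≢-1 v v∞
  ... | just p  | just x₀ = fourAgreements-∞↦just 1≢-1 v v∞
    (trans (cong (to v) (sym v⁻¹∞)) (strictlyInverseˡ v nothing))
  ... | just p  | nothing = contradiction
    (trans (sym v∞) (trans (cong (to v) (sym v⁻¹∞)) (strictlyInverseˡ v nothing))) λ ()

  dist≤q-3 : 1# ≢ - 1# → ∀ v → ∃ λ g → InPGL₂ g × dist v g ℕ.≤ q ℕ.∸ 3
  dist≤q-3 1≢-1 v =
    let g , g∈ , L , u , agree , len = fourAgreements 1≢-1 v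
    -- There are q + 1 points, and `suc q ∸ 4` computes to `q ∸ 3`.
    in g , g∈ , ℕ.∸-monoʳ-≤ (suc q)
         (subst (ℕ._≤ length (fix (λ x → to v (from g x)))) len (agreements≤fix v g u agree))

  -- Lower bound: the Rédei permutation.

  module Rédei (2≢0 : 2# ≢ 0#) {s ε : Carrier} (s²≡-3 : s * s ≡ - 3#) (nonsquare : ∀ x → x * x ≢ ε) where

    -- (x + √ε)³ = `numerator x` + `denominator x` √ε.
    numerator denominator R : Carrier → Carrier
    numerator x = x * x * x + 3# * ε * x
    denominator x = 3# * x * x + ε
    R x = numerator x * denominator x ⁻¹

    ε≢0 : ε ≢ 0#
    ε≢0 ε≡0 = nonsquare 0# (trans (zeroˡ 0#) (sym ε≡0))

    -- Otherwise ε = -3x² = (sx)² would be a square. Hence R has no finite pole.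
    denominator≢0 : ∀ x → denominator x ≢ 0#
    denominator≢0 x eq = nonsquare (s * x) (x-y≡0⇒x≡y (begin
      s * x * (s * x) - ε       ≡⟨ solve 3 (λ s x ε → s :* x :* (s :* x) :- ε := s :* s :* (x :* x) :- ε) refl s x ε ⟩
      s * s * (x * x) - ε       ≡⟨ cong (λ z → z * (x * x) - ε) s²≡-3 ⟩
      - 3# * (x * x) - ε        ≡⟨ solve 2 (λ x ε → :- κ 3 :* (x :* x) :- ε := :- (κ 3 :* x :* x :+ ε)) refl x ε ⟩
      - (3# * x * x + ε)        ≡⟨ cong -_ eq ⟩
      - 0#                      ≡⟨ solve 0 (:- κ 0 := κ 0) refl ⟩
      0#                        ∎))
      where open ≡-Reasoning

    -- Up to sign this is the √ε-coordinate of the cube of (x + √ε)(y - √ε) = (xy - ε) - (x - y)√ε.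
    R-difference : ∀ x y → numerator x * denominator y - numerator y * denominator x ≡
                   (x - y) * (ε * (x - y) * (x - y) + 3# * (x * y - ε) * (x * y - ε))
    R-difference x y = solve 3 (λ ε x y →
      (x :* x :* x :+ κ 3 :* ε :* x) :* (κ 3 :* y :* y :+ ε)
        :- (y :* y :* y :+ κ 3 :* ε :* y) :* (κ 3 :* x :* x :+ ε)
      := (x :- y) :* (ε :* (x :- y) :* (x :- y) :+ κ 3 :* (x :* y :- ε) :* (x :* y :- ε))) refl ε x y

    -- For x ≠ y, the other factor in `R-difference` must vanish. With d = x - y and m = xy - ε this
    -- says εd² = -3m² = (sm)², which makes ε the square of sm/d.
    R-injective : ∀ {x y} → R x ≡ R y → x ≡ y
    R-injective {x} {y} eq with x ≟ y
    ... | yes x≡y = x≡y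
    ... | no  x≢y = contradiction square (nonsquare (s * m * d ⁻¹))
      where
      open ≡-Reasoning
      d m : Carrier
      d = x - y
      m = x * y - ε

      d≢0 : d ≢ 0#
      d≢0 = x≢y⇒x-y≢0 x≢y

      εd²+3m²≡0 : ε * d * d + 3# * m * m ≡ 0#
      εd²+3m²≡0 = x*y≡0⇒y≡0 d≢0 (trans (sym (R-difference x y))
        (x≡y⇒x-y≡0 (cross-multiply (denominator≢0 x) (denominator≢0 y) eq)))

      square : s * m * d ⁻¹ * (s * m * d ⁻¹) ≡ ε
      square = begin
        s * m * d ⁻¹ * (s * m * d ⁻¹)
          ≡⟨ solve 3 (λ s m i → s :* m :* i :* (s :* m :* i) := s :* s :* m :* m :* i :* i) refl s m (d ⁻¹) ⟩
        s * s * m * m * d ⁻¹ * d ⁻¹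
          ≡⟨ cong (λ z → z * m * m * d ⁻¹ * d ⁻¹) s²≡-3 ⟩
        - 3# * m * m * d ⁻¹ * d ⁻¹
          ≡⟨ solve 4 (λ ε d m i → :- κ 3 :* m :* m :* i :* i :=
               ε :* (d :* i) :* (d :* i) :- (ε :* d :* d :+ κ 3 :* m :* m) :* i :* i) refl ε d m (d ⁻¹) ⟩
        ε * (d * d ⁻¹) * (d * d ⁻¹) - (ε * d * d + 3# * m * m) * d ⁻¹ * d ⁻¹
          ≡⟨ cong₂ (λ a b → ε * a * a - b * d ⁻¹ * d ⁻¹) (⁻¹-inverse d d≢0) εd²+3m²≡0 ⟩
        ε * 1# * 1# - 0# * d ⁻¹ * d ⁻¹
          ≡⟨ solve 2 (λ ε i → ε :* κ 1 :* κ 1 :- κ 0 :* i :* i := ε) refl ε (d ⁻¹) ⟩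
        ε ∎

    v,v≡ : Σ (Perm P¹) λ v → ∀ x → to v x ≡ Maybe.map R x
    v,v≡ = injective⇒↔ points-unique ∈-points (Maybe.map R) (map-injective R-injective)

    v : Perm P¹
    v = proj₁ v,v≡

    v≡ : ∀ x → to v x ≡ Maybe.map R x
    v≡ = proj₂ v,v≡

    module _ (a b c d : Carrier) where

      R≡möbius : ∀ x → just (R x) ≡ möbius a b c d (just x) →
                 numerator x * (c * x + d) ≡ (a * x + b) * denominator x
      R≡möbius x eq with (c * x + d) ≟ 0#
      ... | no ≢0 = cross-multiply (denominator≢0 x) ≢0 (just-injective eq)

      -- The coefficients of `numerator`·(cX + d) - (aX + b)·`denominator`; `cubic` omits the
      -- leading coefficient c.
      cubic quartic : List Carrier
      cubic   = - (b * ε) ∷ (3# * ε * d - a * ε) ∷ (3# * ε * c - 3# * b) ∷ (d - 3# * a) ∷ []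
      quartic = - (b * ε) ∷ (3# * ε * d - a * ε) ∷ (3# * ε * c - 3# * b) ∷ (d - 3# * a) ∷ c ∷ []

      quartic-root : ∀ {x} → just (R x) ≡ möbius a b c d (just x) → eval quartic x ≡ 0#
      quartic-root {x} eq = trans
        (solve 6 (λ a b c d ε x →
          :- (b :* ε) :+ x :* ((κ 3 :* ε :* d :- a :* ε) :+ x :* ((κ 3 :* ε :* c :- κ 3 :* b)
            :+ x :* ((d :- κ 3 :* a) :+ x :* (c :+ x :* κ 0))))
          := (x :* x :* x :+ κ 3 :* ε :* x) :* (c :* x :+ d) :- (a :* x :+ b) :* (κ 3 :* x :* x :+ ε))
          refl a b c d ε x)
        (x≡y⇒x-y≡0 (R≡möbius x eq))

      cubic-root : c ≡ 0# → ∀ {x} → just (R x) ≡ möbius a b c d (just x) → eval cubic x ≡ 0#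
      cubic-root c≡0 {x} eq = trans (sym (trans
        (cong (λ z → eval (- (b * ε) ∷ (3# * ε * d - a * ε) ∷ (3# * ε * c - 3# * b) ∷ (d - 3# * a) ∷ z ∷ []) x) c≡0)
        (solve 5 (λ c₀ c₁ c₂ c₃ x →
          c₀ :+ x :* (c₁ :+ x :* (c₂ :+ x :* (c₃ :+ x :* (κ 0 :+ x :* κ 0))))
          := c₀ :+ x :* (c₁ :+ x :* (c₂ :+ x :* (c₃ :+ x :* κ 0)))) refl _ _ _ _ x)))
        (quartic-root eq)

      -- The coefficients of X³ and X give d = 3a and 3εd = εa, so 8εa = 0 and a = 0. With c = 0 the
      -- determinant vanishes.
      cubic≢0 : a * d - b * c ≢ 0# → c ≡ 0# → ¬ All (_≡ 0#) cubic
      cubic≢0 det≢0 c≡0 (_ ∷ c₁≡0 ∷ _ ∷ c₃≡0 ∷ []) = det≢0 (begin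
        a * d - b * c     ≡⟨ cong₂ (λ y z → y * d - b * z) a≡0 c≡0 ⟩
        0# * d - b * 0#   ≡⟨ solve 2 (λ b d → κ 0 :* d :- b :* κ 0 := κ 0) refl b d ⟩
        0#                ∎)
        where
        open ≡-Reasoning
        8εa≡0 : 2# * 2# * 2# * ε * a ≡ 0#
        8εa≡0 = begin
          2# * 2# * 2# * ε * a
            ≡⟨ solve 3 (λ a d ε → κ 2 :* κ 2 :* κ 2 :* ε :* a :=
                 (κ 3 :* ε :* d :- a :* ε) :- κ 3 :* ε :* (d :- κ 3 :* a)) refl a d ε ⟩
          (3# * ε * d - a * ε) - 3# * ε * (d - 3# * a)
            ≡⟨ cong₂ (λ y z → y - 3# * ε * z) c₁≡0 c₃≡0 ⟩
          0# - 3# * ε * 0#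
            ≡⟨ solve 1 (λ ε → κ 0 :- κ 3 :* ε :* κ 0 := κ 0) refl ε ⟩
          0# ∎

        a≡0 : a ≡ 0#
        a≡0 = x*y≡0⇒y≡0 (*-≢0 (*-≢0 (*-≢0 2≢0 2≢0) 2≢0) ε≢0) 8εa≡0

    -- R fixes ∞, so ∞ can be an agreement only if c = 0. In that case the cubic allows three finite
    -- agreements besides ∞; otherwise all agreements are finite and the quartic allows four.
    agreements≤4 : ∀ g → InPGL₂ g → ∀ {L} → Unique L → All (λ x → to v x ≡ to g x) L → length L ℕ.≤ 4
    agreements≤4 g (a , b , c , d , det≢0 , g≡) {L} u agree = cases (c ≟ 0#)
      where
      M = möbius a b c d

      v≡M : ∀ {x} → x ∈ L → Maybe.map R x ≡ M x
      v≡M x∈ = trans (sym (v≡ _)) (trans (All.lookup agree x∈) (g≡ _))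

      agree? : ∀ x → Dec (just (R x) ≡ M (just x))
      agree? x = just (R x) ≟P M (just x)

      xs : List Carrier
      xs = filter agree? elements

      xs-unique : Unique xs
      xs-unique = Unique.filter⁺ agree? elements-unique

      roots : ∀ p → (∀ {x} → just (R x) ≡ M (just x) → eval p x ≡ 0#) → All (λ x → eval p x ≡ 0#) xs
      roots p root = All.tabulate (λ x∈ → root (proj₂ (∈-filter⁻ agree? {xs = elements} x∈)))

      just∈L⇒∈xs : ∀ {x} → just x ∈ L → x ∈ xs
      just∈L⇒∈xs x∈ = ∈-filter⁺ agree? (∈-elements _) (v≡M x∈)

      cases : Dec (c ≡ 0#) → length L ℕ.≤ 4
      cases (yes c≡0) = ℕ.≤-trans
        (unique-⊆⇒length≤ u L⊆) (subst (λ n → suc n ℕ.≤ 4) (sym (length-map just xs)) (s≤s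
          (ℕ.≮⇒≥ λ 3<xs → cubic≢0 a b c d det≢0 c≡0
            (many-roots⇒zero (cubic a b c d) xs-unique (roots (cubic a b c d) (cubic-root a b c d c≡0)) 3<xs))))
        where
        L⊆ : L ⊆ nothing ∷ map just xs
        L⊆ {nothing} _  = here refl
        L⊆ {just x}  x∈ = there (∈-map⁺ just (just∈L⇒∈xs x∈))
      cases (no c≢0) = ℕ.≤-trans
        (unique-⊆⇒length≤ u L⊆) (subst (ℕ._≤ 4) (sym (length-map just xs))
          (ℕ.≮⇒≥ λ 4<xs → c≢0 (leading
            (many-roots⇒zero (quartic a b c d) xs-unique (roots (quartic a b c d) (quartic-root a b c d)) 4<xs))))
        where
        leading : All (_≡ 0#) (quartic a b c d) → c ≡ 0#
        leading (_ ∷ _ ∷ _ ∷ _ ∷ c≡0 ∷ []) = c≡0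

        L⊆ : L ⊆ map just xs
        L⊆ {nothing} x∈ = contradiction (trans (v≡M x∈) (möbius-∞↦just {b = b} {d = d} c≢0)) λ ()
        L⊆ {just x}  x∈ = ∈-map⁺ just (just∈L⇒∈xs x∈)

    q-3≤dist : ∀ g → InPGL₂ g → q ℕ.∸ 3 ℕ.≤ dist v g
    q-3≤dist g g∈ = ℕ.∸-monoʳ-≤ (suc q) (fix≤agreements v g 4 (agreements≤4 g g∈))

-- Combining the two bounds.

theorem2 : (q : ℕ) → IsPrimePower q → q % 6 ≡ 1 → (𝔽 : FiniteField q) →
    ProjectiveLine.CoveringRadiusIs 𝔽 (ProjectiveLine.InPGL₂ 𝔽) (q ∸ 3)
theorem2 q _ q≡1[6] 𝔽 = upper , v , subst (DistToSetIs InPGL₂ v) s≡q-3 v-dist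
  where
  open FieldTheory 𝔽
  open Covering 𝔽
  open ProjectiveLine 𝔽
  open Rédei (2≢0 q≡1[6]) (proj₂ (√-3 q≡1[6])) (proj₂ (nonsquare q≡1[6]))

  upper : ∀ v → Σ ℕ λ s → DistToSetIs InPGL₂ v s × s ℕ.≤ q ∸ 3
  upper v =
    let s , s-dist = distToPGL₂ v
        g , g∈ , dist≤ = dist≤q-3 (1≢-1 q≡1[6]) v
    in s , s-dist , ℕ.≤-trans (proj₂ s-dist g g∈) dist≤

  v-dist : DistToSetIs InPGL₂ v (proj₁ (upper v))
  v-dist = proj₁ (proj₂ (upper v))

  -- The distance of the Rédei permutation is attained at some `g`, where the lower bound applies;
  -- the upper bound holds for every permutation.
  s≡q-3 : proj₁ (upper v) ≡ q ∸ 3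
  s≡q-3 =
    let (g , g∈ , dist≡s) , _ = v-dist
    in ℕ.≤-antisym (proj₂ (proj₂ (upper v))) (subst (q ∸ 3 ℕ.≤_) dist≡s (q-3≤dist g g∈))
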